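{- Let $A$ be a finite set with $|A|\ge 2$, let $n\ge 2$, and let $f$ be a permutation of $A^n$. If $n=2m$ is even, then $f$ can be computed in at most $3m$ instructions with $m$ memory cells. If $n=2m+1$ is odd, then $f$ can be computed in at most $3m+3$ instructions with $m+2$ memory cells.
   Context: For $N\ge1$, a transformation of $A^N$ is a map $h=(h_1,\dots,h_N):A^N\to A^N$; its coordinate function $h_i:A^N\to A$ is trivial if $h_i(x)=x_i$ for all $x$. An instruction of $A^N$ is a transformation of $A^N$ with at most one nontrivial coordinate function. A program of length $L$ computing $h$ is a sequence of instructions $g^1,\dots,g^L$ of $A^N$ with $h=g^L\circ\cdots\circ g^1$. A transformation $f$ of $A^n$ is said to be computed in $L$ instructions with $k$ memory cells if there is a program of length $L$ (with instructions of $A^{n+k}$) computing some transformation $h$ of $A^{n+k}$ with $h_i(x_1,\dots,x_{n+k})=f_i(x_1,\dots,x_n)$ for all $1\le i\le n$ and all $(x_1,\dots,x_{n+k})\in A^{n+k}$. -}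

module Defs where

open import Data.Fin.Base using (Fin; _↑ˡ_)
open import Data.Nat.Base using (ℕ; _+_; _≤_)
open import Data.Product.Base using (Σ; ∃-syntax; _×_; proj₁)
open import Data.Vec.Base using (Vec; []; _∷_; _++_; lookup)
open import Function.Base using (id; _∘_)
open import Function.Definitions using (Bijective)
open import Level using (Level)
open import Relation.Binary.PropositionalEquality.Core using (_≡_; _≗_)
open import Relation.Nullary.Negation.Core using (¬_)

private
  variable
    a : Level

Transformation : Set a → ℕ → Set a
Transformation A N = Vec A N → Vec A N

IsPermutation : {A : Set a} {N : ℕ} → Transformation A N → Set a
IsPermutation f = Bijective _≡_ _≡_ f

coordinate : {A : Set a} {N : ℕ} → Transformation A N → Fin N → Vec A N → A
coordinate h i x = lookup (h x) i

Trivial : {A : Set a} {N : ℕ} → Transformation A N → Fin N → Set a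
Trivial h i = ∀ x → coordinate h i x ≡ lookup x i

IsInstruction : {A : Set a} {N : ℕ} → Transformation A N → Set a
IsInstruction g = ∀ i j → ¬ Trivial g i → ¬ Trivial g j → i ≡ j

Instruction : Set a → ℕ → Set a
Instruction A N = Σ (Transformation A N) IsInstruction

Program : Set a → ℕ → ℕ → Set a
Program A N L = Vec (Instruction A N) L

-- The head of the vector is executed first.
run : {A : Set a} {N L : ℕ} → Program A N L → Transformation A N
run []      = id
run (g ∷ p) = run p ∘ proj₁ g

-- Transformations are compared pointwise, as function extensionality is
-- not available.
_Computes_ : {A : Set a} {N L : ℕ} → Program A N L → Transformation A N → Set a
p Computes h = h ≗ run p

-- The memory cells are the last k coordinates; their initial contents y are
-- arbitrary and their final contents are unconstrained.
ComputedIn :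
  {A : Set a} {n : ℕ} → Transformation A n → (L k : ℕ) → Set a
ComputedIn {A = A} {n} f L k =
  Σ (Program A (n + k) L) λ p →
  Σ (Transformation A (n + k)) λ h →
    p Computes h ×
    (∀ (i : Fin n) (x : Vec A n) (y : Vec A k) →
       coordinate h (i ↑ˡ k) (x ++ y) ≡ coordinate f i x)

ComputedInAtMost : {A : Set a} {n : ℕ} → Transformation A n → (L k : ℕ) → Set a
ComputedInAtMost f L k =
  ∃[ L′ ] L′ ≤ L × ComputedIn f L′ k

{-# OPTIONS --safe #-}

-- Write f (u , v) = (f₁ , f₂) with u, v ∈ B = A^m, and regard each (u , v) as an
-- edge joining v to f₁ in a bipartite multigraph. It is |B|-regular because f
-- is a permutation, so by König's theorem its edges have a proper colouring w
-- with colours in B. Then (v , w) and (f₁ , w) both determine (u , v), and the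
-- three assignments  memory := w,  u := f₁,  v := f₂  of m instructions each
-- compute f. In the odd case f is extended by the identity on one memory cell.
--
-- König's theorem is proved by decomposing the permutation that matches up the
-- endpoints into transpositions; each of them only requires a recolouring
-- within the union of two colour classes.

module Submission where

open import Defs
open import Data.Bool.Base using (Bool; true; false; if_then_else_)
open import Data.Fin.Base
  using (Fin; zero; suc; toℕ; cast; combine; punchOut; remQuot; splitAt; _↑ˡ_; _↑ʳ_)
open import Data.Fin.Permutation using (Permutation′; _⟨$⟩ʳ_)
open import Data.Fin.Permutation.Components using (transpose)
open import Data.Fin.Permutation.Transposition.List
  using (TranspositionList; eval; decompose; eval-decompose)
open import Data.Fin.Properties
  using (_≟_; any?; *↔×; combine-injective; combine-remQuot; injective⇒≤;
    pigeonhole; remQuot-combine; punchOut-injective; splitAt-↑ˡ; splitAt-↑ʳ;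
    toℕ-cast; toℕ-injective; toℕ-↑ˡ; ↑ʳ-injective; ↑ˡ-injective)
open import Data.List.Base using ([]; _∷_)
open import Data.Nat.Base using (ℕ; zero; suc; _+_; _*_; _^_; _≤_; _<_)
open import Data.Nat.DivMod using (_/_; _%_; m%n<n; m≡m%n+[m/n]*n)
open import Data.Nat.GeneralisedArithmetic using (fold; fold-+)
open import Data.Nat.Properties as ℕ using (_<?_)
open import Data.Product.Base using (Σ; ∃; ∃-syntax; _×_; _,_; proj₁; proj₂; uncurry)
open import Data.Product.Function.NonDependent.Propositional using (_×-↔_)
open import Data.Product.Algebra using (×-comm)
open import Data.Sum.Base using (_⊎_; inj₁; inj₂)
open import Data.Vec.Base
  using (Vec; []; _∷_; _++_; drop; head; lookup; tabulate; tail; take; _[_]≔_)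
open import Data.Vec.Properties
  using (lookup-++ˡ; lookup∘tabulate; lookup∘update; lookup∘update′; tabulate-cong;
    tabulate∘lookup; take++drop≡id; ++-injective)
open import Function.Base using (id; _∘_; case_of_)
open import Function.Bundles using (_↔_; Inverse; mk↔ₛ′)
open import Function.Construct.Composition using (_↔-∘_)
open import Function.Construct.Symmetry using (↔-sym)
open import Function.Definitions using (Injective)
open import Level using (Level)
open import Relation.Binary.PropositionalEquality
open import Relation.Nullary using (¬_; Dec; does; yes; no; contradiction)
open import Relation.Nullary.Decidable using (_⊎-dec_; dec-true; dec-false)

open ≡-Reasoning

-- Injective self-maps of finite sets.

private
  variable
    ℓ ℓ′ : Level
    X : Set ℓ
    M : ℕ

  Inj : {X : Set ℓ} → (X → X) → Set ℓ
  Inj = Injective _≡_ _≡_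

-- If `y` were missed, punching it out of the codomain would turn `g` into an injection from
-- `Fin (suc M)` to `Fin M`.
injective⇒surjective : {g : Fin M → Fin M} → Inj g → ∀ y → ∃[ x ] g x ≡ y
injective⇒surjective {suc M} {g} g-inj y with any? (λ x → g x ≟ y)
... | yes hit = hit
... | no miss = contradiction (injective⇒≤ {f = g′} g′-inj) ℕ.1+n≰n
  where
  y≢g : ∀ x → y ≢ g x
  y≢g x y≡gx = miss (x , sym y≡gx)

  g′ : Fin (suc M) → Fin M
  g′ x = punchOut (y≢g x)

  g′-inj : Injective _≡_ _≡_ g′
  g′-inj {x} {x′} eq = g-inj (punchOut-injective (y≢g x) (y≢g x′) eq)

↔-injective : {Y : Set ℓ′} (i : X ↔ Y) → Injective _≡_ _≡_ (Inverse.to i)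
↔-injective i {x} {x′} eq = begin
  x             ≡⟨ Inverse.strictlyInverseʳ i x ⟨
  from (to x)   ≡⟨ cong from eq ⟩
  from (to x′)  ≡⟨ Inverse.strictlyInverseʳ i x′ ⟩
  x′            ∎
  where open Inverse i using (to; from)

finite-injective⇒section : X ↔ Fin M → {g : X → X} → Inj g →
                          ∃ λ (h : X → X) → ∀ y → g (h y) ≡ y
finite-injective⇒section i {g} g-inj =
  (λ y → from (proj₁ (surjective (to y)))) ,
  (λ y → ↔-injective i (proj₂ (surjective (to y))))
  where
  open Inverse i using (to; from)

  surjective : ∀ y → ∃[ x ] to (g (from x)) ≡ y
  surjective = injective⇒surjective
    (λ eq → ↔-injective (↔-sym i) (g-inj (↔-injective i eq)))

finite-injective⇒↔ : X ↔ Fin M → {g : X → X} → Inj g → X ↔ X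
finite-injective⇒↔ i {g} g-inj =
  let h , g∘h = finite-injective⇒section i g-inj
  in mk↔ₛ′ g h g∘h (λ x → g-inj (g∘h (g x)))

-- Orbits of injective self-maps of Fin M

bounded-argmin : (s : ℕ → ℕ) (p : ℕ) → ∃[ k ] (∀ j → j ≤ p → s k ≤ s j)
bounded-argmin s zero = 0 , λ j j≤0 → ℕ.≤-reflexive (cong s (sym (ℕ.n≤0⇒n≡0 j≤0)))
bounded-argmin s (suc p) with bounded-argmin s p
... | k , k-min with ℕ.≤-total (s k) (s (suc p))
...   | inj₁ sk≤ = k , λ j j≤ → case ℕ.m≤n⇒m<n∨m≡n j≤ of λ where
          (inj₁ j<) → k-min j (ℕ.≤-pred j<)
          (inj₂ refl) → sk≤
...   | inj₂ ≤sk = suc p , λ j j≤ → case ℕ.m≤n⇒m<n∨m≡n j≤ of λ where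
          (inj₁ j<) → ℕ.≤-trans ≤sk (k-min j (ℕ.≤-pred j<))
          (inj₂ refl) → ℕ.≤-refl

-- Every index reduces modulo the period `suc p` to one that is at most `p`, so the minimum over one
-- period is global.
periodic-argmin : (s : ℕ → ℕ) (p : ℕ) → (∀ j → s (j + suc p) ≡ s j) →
                  ∃[ k ] (∀ j → s k ≤ s j)
periodic-argmin s p period with bounded-argmin s p
... | k , k-min = k , λ j → ℕ.≤-trans (k-min (j % suc p) (ℕ.≤-pred (m%n<n j (suc p))))
    (ℕ.≤-reflexive (sym (trans
      (cong s (m≡m%n+[m/n]*n j (suc p)))
      (periods (j % suc p) (j / suc p)))))
  where
  periods : ∀ r d → s (r + d * suc p) ≡ s r
  periods r zero    = cong s (ℕ.+-identityʳ r)
  periods r (suc d) = begin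
    s (r + (suc p + d * suc p)) ≡⟨ cong (λ x → s (r + x)) (ℕ.+-comm (suc p) (d * suc p)) ⟩
    s (r + (d * suc p + suc p)) ≡⟨ cong s (ℕ.+-assoc r (d * suc p) (suc p)) ⟨
    s (r + d * suc p + suc p)   ≡⟨ period (r + d * suc p) ⟩
    s (r + d * suc p)           ≡⟨ periods r d ⟩
    s r                         ∎

fold-shift : (ρ : X → X) (x : X) (n : ℕ) → fold (ρ x) ρ n ≡ ρ (fold x ρ n)
fold-shift ρ x zero    = refl
fold-shift ρ x (suc n) = cong ρ (fold-shift ρ x n)

module Orbit (ρ : Fin M → Fin M) (ρ-inj : Inj ρ) where

  iterates-cancel : ∀ {x y} n → fold x ρ n ≡ fold y ρ n → x ≡ y
  iterates-cancel zero    eq = eq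
  iterates-cancel (suc n) eq = iterates-cancel n (ρ-inj eq)

  -- Two of the iterates numbered 0 to `M` coincide by the pigeonhole principle, and injectivity
  -- cancels the steps they share.
  period : ∀ x → ∃[ p ] fold x ρ (suc p) ≡ x
  period x with pigeonhole (ℕ.n<1+n M) (λ i → fold x ρ (toℕ i))
  ... | i , j , i<j , eq with ℕ.m≤n⇒∃[o]m+o≡n i<j
  ...   | p , i+p≡j = p , sym (iterates-cancel (toℕ i) (begin
    fold x ρ (toℕ i)                   ≡⟨ eq ⟩
    fold x ρ (toℕ j)                   ≡⟨ cong (fold x ρ) (trans (ℕ.+-suc (toℕ i) p) i+p≡j) ⟨
    fold x ρ (toℕ i + suc p)           ≡⟨ fold-+ x ρ (toℕ i) ⟩
    fold (fold x ρ (suc p)) ρ (toℕ i)  ∎))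

  +-period : ∀ x j → fold x ρ (j + suc (proj₁ (period x))) ≡ fold x ρ j
  +-period x j = trans (fold-+ x ρ j) (cong (λ y → fold y ρ j) (proj₂ (period x)))

  argmin : ∀ x → ∃[ k ] (∀ j → toℕ (fold x ρ k) ≤ toℕ (fold x ρ j))
  argmin x = periodic-argmin (λ j → toℕ (fold x ρ j)) (proj₁ (period x)) (cong toℕ ∘ +-period x)

  least : Fin M → Fin M
  least x = fold x ρ (proj₁ (argmin x))

  least-≤ : ∀ x j → toℕ (least x) ≤ toℕ (fold x ρ j)
  least-≤ x = proj₂ (argmin x)

  least-ρ : ∀ x → least (ρ x) ≡ least x
  least-ρ x = toℕ-injective (ℕ.≤-antisym
    (subst (λ y → toℕ (least (ρ x)) ≤ toℕ y) later (least-≤ (ρ x) (k + p)))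
    (subst (λ y → toℕ (least x) ≤ toℕ y) (sym (fold-shift ρ x k′)) (least-≤ x (suc k′))))
    where
    k = proj₁ (argmin x)
    k′ = proj₁ (argmin (ρ x))
    p = proj₁ (period x)

    -- The least element lies `k` steps after `x`, hence `k - 1` steps after `ρ x`; since `k` may be
    -- 0, one whole period `suc p` is added.
    later : fold (ρ x) ρ (k + p) ≡ least x
    later = begin
      fold (ρ x) ρ (k + p)  ≡⟨ fold-shift ρ x (k + p) ⟩
      fold x ρ (suc k + p)  ≡⟨ cong (fold x ρ) (ℕ.+-suc k p) ⟨
      fold x ρ (k + suc p)  ≡⟨ +-period x k ⟩
      fold x ρ k            ∎

-- Two-colourings that alternate along two pairings.

-- `partner` is an involution on all of `Fin M`, while the absence of fixed points is required on
-- `S` only. Thus a composite of two partners is injective on all of `Fin M`, and its orbits can be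
-- studied without passing to a subtype.
record Pairing (S : Fin M → Set) : Set where
  field
    partner    : Fin M → Fin M
    involutive : ∀ e → partner (partner e) ≡ e
    closed     : ∀ {e} → S e → S (partner e)
    moves      : ∀ {e} → S e → partner e ≢ e

  Alternates : (Fin M → Bool) → Set
  Alternates χ = ∀ {e} → S e → χ e ≢ χ (partner e)

-- On the set of orbits of ρ = τ ∘ σ that meet S, σ and τ induce the same
-- involution, which has no fixed points. So comparing the least elements of the
-- orbits of e and of σ e alternates along both pairings.
module TwoPairings {S : Fin M → Set} (P Q : Pairing S) where
  open Pairing P renaming (partner to σ; involutive to σσ; closed to σ-closed; moves to σ-moves)
  open Pairing Q renaming (partner to τ; involutive to ττ; closed to τ-closed; moves to τ-moves)

  ρ : Fin M → Fin M
  ρ e = τ (σ e)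

  ρ-inj : Inj ρ
  ρ-inj {x} {y} eq = begin
    x                  ≡⟨ σσ x ⟨
    σ (σ x)            ≡⟨ cong σ (ττ (σ x)) ⟨
    σ (τ (ρ x))        ≡⟨ cong (σ ∘ τ) eq ⟩
    σ (τ (ρ y))        ≡⟨ cong σ (ττ (σ y)) ⟩
    σ (σ y)            ≡⟨ σσ y ⟩
    y                  ∎

  open Orbit ρ ρ-inj

  -- If `σ e` lies `k + 2` steps after `e` under `ρ`, then `σ (ρ e)` lies `k` steps after `ρ e`.
  -- Descending by two ends in a fixed point of `σ` or of `τ` within `S`.
  σ∉orbit : ∀ k {e} → S e → σ e ≢ fold e ρ k
  σ∉orbit zero          s eq = σ-moves s eq
  σ∉orbit (suc zero)    s eq = τ-moves (σ-closed s) (sym eq)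
  σ∉orbit (suc (suc k)) {e} s eq = σ∉orbit k (τ-closed (σ-closed s)) (begin
    σ (ρ e)                    ≡⟨⟩
    σ (τ (σ e))                ≡⟨ cong (σ ∘ τ) eq ⟩
    σ (τ (ρ (fold e ρ (suc k)))) ≡⟨ cong σ (ττ _) ⟩
    σ (σ (fold e ρ (suc k)))   ≡⟨ σσ _ ⟩
    fold e ρ (suc k)           ≡⟨ fold-shift ρ e k ⟨
    fold (ρ e) ρ k             ∎)

  -- `σ` conjugates `ρ` to its inverse: when `e` is replaced by its `ρ`-predecessor `σ (τ e)`, its
  -- `σ`-image becomes `ρ (σ e)`. So the steps taken from `σ e` are transferred to `e` until
  -- `σ∉orbit` applies.
  orbits-disjoint : ∀ j k {e} → S e → fold (σ e) ρ j ≢ fold e ρ k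
  orbits-disjoint zero    k s eq = σ∉orbit k s eq
  orbits-disjoint (suc j) k {e} s eq = orbits-disjoint j (suc k) (σ-closed (τ-closed s)) (begin
    fold (σ (σ (τ e))) ρ j   ≡⟨ cong (λ x → fold x ρ j) (σσ (τ e)) ⟩
    fold (τ e) ρ j           ≡⟨ cong (λ x → fold (τ x) ρ j) (σσ e) ⟨
    fold (ρ (σ e)) ρ j       ≡⟨ fold-shift ρ (σ e) j ⟩
    fold (σ e) ρ (suc j)     ≡⟨ eq ⟩
    fold e ρ k               ≡⟨ cong (λ x → fold x ρ k) ρστ ⟨
    fold (ρ (σ (τ e))) ρ k   ≡⟨ fold-shift ρ (σ (τ e)) k ⟩
    fold (σ (τ e)) ρ (suc k) ∎)
    where
    ρστ : ρ (σ (τ e)) ≡ e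
    ρστ = trans (cong τ (σσ (τ e))) (ττ e)

  χ : Fin M → Bool
  χ e = does (toℕ (least e) <? toℕ (least (σ e)))

  <?-swap-≢ : ∀ {x y} → x ≢ y → (x<?y : Dec (x < y)) (y<?x : Dec (y < x)) → does x<?y ≢ does y<?x
  <?-swap-≢ x≢y (yes x<y) (yes y<x) eq = ℕ.<-asym x<y y<x
  <?-swap-≢ x≢y (yes _)   (no _)    ()
  <?-swap-≢ x≢y (no _)    (yes _)   ()
  <?-swap-≢ x≢y (no x≮y)  (no y≮x)  eq = x≢y (ℕ.≤-antisym (ℕ.≮⇒≥ y≮x) (ℕ.≮⇒≥ x≮y))

  swapped-≢ : ∀ {e} → S e → χ e ≢ does (toℕ (least (σ e)) <? toℕ (least e))
  swapped-≢ {e} s = <?-swap-≢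
    (λ eq → orbits-disjoint (proj₁ (argmin (σ e))) (proj₁ (argmin e)) s (sym (toℕ-injective eq)))
    (toℕ (least e) <? toℕ (least (σ e))) (toℕ (least (σ e)) <? toℕ (least e))

  alternates-σ : Pairing.Alternates P χ
  alternates-σ {e} s eq = swapped-≢ s (trans eq
    (cong (λ x → does (toℕ (least (σ e)) <? toℕ (least x))) (σσ e)))

  alternates-τ : Pairing.Alternates Q χ
  alternates-τ {e} s eq = swapped-≢ s (trans eq
    (cong₂ (λ x y → does (toℕ x <? toℕ y)) leastτ leastστ))
    where
    -- `τ e` is `ρ (σ e)`, and `e` is `ρ (σ (τ e))`; `least` is constant along `ρ`.
    leastτ : least (τ e) ≡ least (σ e)
    leastτ = trans (cong (least ∘ τ) (sym (σσ e))) (least-ρ (σ e))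

    leastστ : least (σ (τ e)) ≡ least e
    leastστ = trans (sym (least-ρ (σ (τ e)))) (cong least (trans (cong τ (σσ (τ e))) (ττ e)))

alternating : {S : Fin M → Set} (P Q : Pairing S) →
              ∃[ χ ] Pairing.Alternates P χ × Pairing.Alternates Q χ
alternating P Q =
  TwoPairings.χ P Q , TwoPairings.alternates-σ P Q , TwoPairings.alternates-τ P Q

-- If `P` pairs edges that meet under an endpoint map `r`, the result pairs edges that meet under
-- `r ∘ t`. The colouring at hand may fail to be proper for `r ∘ t`, so the pairing there cannot be
-- read off from it directly.
conjugate : {S : Fin M → Set} → Pairing S → (t : Fin M → Fin M) → (∀ e → t (t e) ≡ e) →
            (∀ {e} → S e → S (t e)) → Pairing S
conjugate P t tt t-closed = record
  { partner    = λ e → t (partner (t e))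
  ; involutive = λ e → begin
      t (partner (t (t (partner (t e)))))  ≡⟨ cong (t ∘ partner) (tt _) ⟩
      t (partner (partner (t e)))          ≡⟨ cong t (involutive _) ⟩
      t (t e)                              ≡⟨ tt e ⟩
      e                                    ∎
  ; closed     = t-closed ∘ closed ∘ t-closed
  ; moves      = λ {e} s eq → moves (t-closed s) (trans (sym (tt _)) (cong t eq))
  }
  where open Pairing P using (partner; involutive; closed; moves)

-- König's edge colouring of a regular bipartite multigraph

transpose-matchˡ : ∀ (i j : Fin M) → transpose i j i ≡ j
transpose-matchˡ i j rewrite dec-true (i ≟ i) refl = refl

transpose-matchʳ : ∀ (i j : Fin M) → transpose i j j ≡ i
transpose-matchʳ i j with j ≟ i
... | yes j≡i = j≡i
... | no  _   rewrite dec-true (j ≟ j) refl = refl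

transpose-mismatch : ∀ {i j k : Fin M} → k ≢ i → k ≢ j → transpose i j k ≡ k
transpose-mismatch {i = i} {j} {k} k≢i k≢j
  rewrite dec-false (k ≟ i) k≢i | dec-false (k ≟ j) k≢j = refl

transpose-elim : ∀ {i j : Fin M} (P : Fin M → Fin M → Set ℓ) → P i j → P j i →
                 (∀ {k} → k ≢ i → k ≢ j → P k k) → ∀ k → P k (transpose i j k)
transpose-elim {i = i} {j} P Pij Pji Pkk k = by-cases (k ≟ i) (k ≟ j)
  where
  by-cases : Dec (k ≡ i) → Dec (k ≡ j) → P k (transpose i j k)
  by-cases (yes refl) _          = subst (P i) (sym (transpose-matchˡ i j)) Pij
  by-cases (no _)     (yes refl) = subst (P j) (sym (transpose-matchʳ i j)) Pji
  by-cases (no k≢i)   (no k≢j)   = subst (P k) (sym (transpose-mismatch k≢i k≢j)) (Pkk k≢i k≢j)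

transpose-involutive : ∀ (i j k : Fin M) → transpose i j (transpose i j k) ≡ k
transpose-involutive i j = transpose-elim (λ k k′ → transpose i j k′ ≡ k)
  (transpose-matchʳ i j) (transpose-matchˡ i j) transpose-mismatch

transpose-invariant : {Y : Set ℓ} (g : Fin M → Y) {i j : Fin M} → g i ≡ g j →
                      ∀ k → g (transpose i j k) ≡ g k
transpose-invariant g gi≡gj = transpose-elim (λ k k′ → g k′ ≡ g k) (sym gi≡gj) gi≡gj (λ _ _ → refl)

-- A b-regular bipartite multigraph on a + a vertices has a * b edges; r maps an
-- edge to its endpoint on one side. A proper c has exactly one edge of each
-- colour at each vertex of that side (edge-of), by counting.
Proper : ∀ a b → (Fin (a * b) → Fin a) → (Fin (a * b) → Fin b) → Set
Proper a b r c = ∀ {e e′} → r e ≡ r e′ → c e ≡ c e′ → e ≡ e′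

edge-of : ∀ {a b r c} → Proper a b r c → ∀ v γ → ∃[ e ] r e ≡ v × c e ≡ γ
edge-of {r = r} {c} proper v γ =
  let e , eq = injective⇒surjective {g = λ e → combine (r e) (c e)}
                 (λ eq → uncurry proper (combine-injective _ _ _ _ eq)) (combine v γ)
  in e , combine-injective _ _ _ _ eq

module Recolouring {a b : ℕ} (c : Fin (a * b) → Fin b) {α β : Fin b} (α≢β : α ≢ β) where

  Bichromatic : Fin (a * b) → Set
  Bichromatic e = c e ≡ α ⊎ c e ≡ β

  bichromatic? : ∀ e → Dec (Bichromatic e)
  bichromatic? e = (c e ≟ α) ⊎-dec (c e ≟ β)

  pick : Bool → Fin b
  pick χ = if χ then α else β

  pick-injective : ∀ x y → pick x ≡ pick y → x ≡ y
  pick-injective true  true  _  = refl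
  pick-injective true  false eq = contradiction eq α≢β
  pick-injective false true  eq = contradiction (sym eq) α≢β
  pick-injective false false _  = refl

  recolour : (Fin (a * b) → Bool) → Fin (a * b) → Fin b
  recolour χ e with bichromatic? e
  ... | yes _ = pick (χ e)
  ... | no _  = c e

  ≢pick : ∀ {e} x → ¬ Bichromatic e → c e ≢ pick x
  ≢pick true  ¬s eq = ¬s (inj₁ eq)
  ≢pick false ¬s eq = ¬s (inj₂ eq)

  -- Recoloured edges stay within `α` and `β`, so an edge inside the two classes never clashes with
  -- one outside. Outside, colours are unchanged; inside, an edge shares a vertex only with its
  -- partner, and `χ` separates the two.
  recolour-proper : ∀ {r : Fin (a * b) → Fin a} (P : Pairing Bichromatic) →
    (∀ {e e′} → ¬ Bichromatic e → ¬ Bichromatic e′ → r e ≡ r e′ → c e ≡ c e′ → e ≡ e′) →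
    (∀ {e e′} → Bichromatic e → Bichromatic e′ → r e ≡ r e′ →
      e ≡ e′ ⊎ Pairing.partner P e ≡ e′) →
    ∀ {χ} → Pairing.Alternates P χ → Proper a b r (recolour χ)
  recolour-proper P proper paired {χ} alternates {e} {e′} meet same
    with bichromatic? e | bichromatic? e′
  ... | yes s | no ¬s′ = contradiction (sym same) (≢pick (χ e) ¬s′)
  ... | no ¬s | yes s′ = contradiction same (≢pick (χ e′) ¬s)
  ... | no ¬s | no ¬s′ = proper ¬s ¬s′ meet same
  ... | yes s | yes s′ with paired s s′ meet
  ...   | inj₁ e≡e′ = e≡e′
  ...   | inj₂ refl = contradiction (pick-injective (χ e) _ same) (alternates s)

  transpose-α : ∀ {γ} → γ ≡ α → transpose α β γ ≡ β
  transpose-α refl = transpose-matchˡ α β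

  transpose-β : ∀ {γ} → γ ≡ β → transpose α β γ ≡ α
  transpose-β refl = transpose-matchʳ α β

  complementary : ∀ {e e′} → Bichromatic e → Bichromatic e′ →
                  c e ≡ c e′ ⊎ transpose α β (c e) ≡ c e′
  complementary (inj₁ p) (inj₁ q) = inj₁ (trans p (sym q))
  complementary (inj₂ p) (inj₂ q) = inj₁ (trans p (sym q))
  complementary (inj₁ p) (inj₂ q) = inj₂ (trans (transpose-α p) (sym q))
  complementary (inj₂ p) (inj₁ q) = inj₂ (trans (transpose-β p) (sym q))

  module _ {r : Fin (a * b) → Fin a} (proper : Proper a b r c) where

    -- An edge of a third colour is its own mate, because `transpose α β` fixes its colour; so this
    -- is an involution on all edges.
    mate : Fin (a * b) → Fin (a * b)
    mate e = proj₁ (edge-of proper (r e) (transpose α β (c e)))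

    r-mate : ∀ e → r (mate e) ≡ r e
    r-mate e = proj₁ (proj₂ (edge-of proper (r e) (transpose α β (c e))))

    c-mate : ∀ e → c (mate e) ≡ transpose α β (c e)
    c-mate e = proj₂ (proj₂ (edge-of proper (r e) (transpose α β (c e))))

    mate-involutive : ∀ e → mate (mate e) ≡ e
    mate-involutive e = proper (trans (r-mate (mate e)) (r-mate e)) (begin
      c (mate (mate e))                   ≡⟨ c-mate (mate e) ⟩
      transpose α β (c (mate e))          ≡⟨ cong (transpose α β) (c-mate e) ⟩
      transpose α β (transpose α β (c e)) ≡⟨ transpose-involutive α β (c e) ⟩
      c e                                 ∎)

    mate-closed : ∀ {e} → Bichromatic e → Bichromatic (mate e)
    mate-closed {e} (inj₁ p) = inj₂ (trans (c-mate e) (transpose-α p))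
    mate-closed {e} (inj₂ p) = inj₁ (trans (c-mate e) (transpose-β p))

    mate-moves : ∀ {e} → Bichromatic e → mate e ≢ e
    mate-moves {e} (inj₁ p) eq =
      α≢β (trans (sym p) (trans (cong c (sym eq)) (trans (c-mate e) (transpose-α p))))
    mate-moves {e} (inj₂ p) eq =
      α≢β (trans (sym (transpose-β p)) (trans (sym (c-mate e)) (trans (cong c eq) p)))

    mates : Pairing Bichromatic
    mates = record
      { partner    = mate
      ; involutive = mate-involutive
      ; closed     = mate-closed
      ; moves      = mate-moves
      }

    meet⇒mates : ∀ {e e′} → Bichromatic e → Bichromatic e′ → r e ≡ r e′ →
                 e ≡ e′ ⊎ mate e ≡ e′
    meet⇒mates {e} s s′ meet with complementary s s′
    ... | inj₁ same = inj₁ (proper meet same)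
    ... | inj₂ swap = inj₂ (proper (trans (r-mate e) meet) (trans (c-mate e) swap))

  -- Permuting the endpoints of the edges of colours α and β only affects
  -- properness within the union of these two colour classes, which is split
  -- again into two matchings.
  recolour-permuted : ∀ {l r} → Proper a b l c → Proper a b r c →
    (t : Fin (a * b) → Fin (a * b)) → (∀ e → t (t e) ≡ e) →
    (∀ {e} → Bichromatic e → Bichromatic (t e)) → (∀ {e} → ¬ Bichromatic e → t e ≡ e) →
    ∃[ c′ ] Proper a b l c′ × Proper a b (r ∘ t) c′
  recolour-permuted {l} {r} proper-l proper-r t tt t-closed t-fixes =
    let χ , alternates-l , alternates-r = alternating (mates proper-l) mates-rt in
    recolour χ ,
    recolour-proper (mates proper-l) (λ _ _ → proper-l) (meet⇒mates proper-l) alternates-l ,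
    recolour-proper mates-rt
      (λ ¬s ¬s′ meet → proper-r (subst₂ (λ x y → r x ≡ r y) (t-fixes ¬s) (t-fixes ¬s′) meet))
      meet⇒mates-rt alternates-r
    where
    mates-rt : Pairing Bichromatic
    mates-rt = conjugate (mates proper-r) t tt t-closed

    meet⇒mates-rt : ∀ {e e′} → Bichromatic e → Bichromatic e′ → r (t e) ≡ r (t e′) →
                    e ≡ e′ ⊎ t (mate proper-r (t e)) ≡ e′
    meet⇒mates-rt s s′ meet with meet⇒mates proper-r (t-closed s) (t-closed s′) meet
    ... | inj₁ eq = inj₁ (trans (sym (tt _)) (trans (cong t eq) (tt _)))
    ... | inj₂ eq = inj₂ (trans (cong t eq) (tt _))

-- If `i` and `j` have the same colour, the exchange preserves colours and `c` itself stays proper.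
-- Otherwise their colours serve as `α` and `β`: both edges are bichromatic, and every edge of a
-- third colour is fixed.
exchange-endpoints : ∀ {a b l r c} → Proper a b l c → Proper a b r c → ∀ i j →
                     ∃[ c′ ] Proper a b l c′ × Proper a b (r ∘ transpose i j) c′
exchange-endpoints {a} {c = c} proper-l proper-r i j with c i ≟ c j
... | yes ci≡cj = c , proper-l , λ {e} {e′} meet same → begin
    e                                 ≡⟨ transpose-involutive i j e ⟨
    transpose i j (transpose i j e)   ≡⟨ cong (transpose i j) (proper-r meet (begin
        c (transpose i j e)             ≡⟨ transpose-invariant c {i} {j} ci≡cj e ⟩
        c e                             ≡⟨ same ⟩
        c e′                            ≡⟨ transpose-invariant c ci≡cj e′ ⟨
        c (transpose i j e′)            ∎)) ⟩
    transpose i j (transpose i j e′)  ≡⟨ transpose-involutive i j e′ ⟩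
    e′                                ∎
... | no ci≢cj = Recolouring.recolour-permuted c ci≢cj proper-l proper-r
    (transpose i j) (transpose-involutive i j)
    (transpose-elim (λ e e′ → Bichromatic e → Bichromatic e′)
      (λ _ → inj₂ refl) (λ _ → inj₁ refl) (λ _ _ s → s) _)
    (λ ¬s → transpose-mismatch (λ { refl → ¬s (inj₁ refl) }) (λ { refl → ¬s (inj₂ refl) }))
  where
  Bichromatic = Recolouring.Bichromatic {a} c ci≢cj

-- A transposition at the head of the list precomposes `eval ts`, which is the change of endpoints
-- that `exchange-endpoints` handles. Colours may change at each step, but properness for `l` is
-- carried along.
colour-transpositions : ∀ {a b l c} → Proper a b l c → (ts : TranspositionList (a * b)) →
                        ∃[ c′ ] Proper a b l c′ × Proper a b (l ∘ (eval ts ⟨$⟩ʳ_)) c′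
colour-transpositions {c = c} proper []             = c , proper , proper
colour-transpositions         proper ((i , j) ∷ ts) =
  let _ , proper-l , proper-r = colour-transpositions proper ts
  in exchange-endpoints proper-l proper-r i j

endpoint : ∀ a b → Fin (a * b) → Fin a
endpoint a b e = proj₁ (remQuot {a} b e)

colouring : ∀ {a b} (π : Permutation′ (a * b)) →
            ∃[ c ] Proper a b (endpoint a b) c × Proper a b (endpoint a b ∘ (π ⟨$⟩ʳ_)) c
colouring {a} {b} π =
  let c , proper-l , proper-r = colour-transpositions base (decompose π)
  in c , proper-l , λ meet same → proper-r
       (trans (cong (endpoint a b) (eval-decompose π _))
         (trans meet (cong (endpoint a b) (sym (eval-decompose π _)))))
       same
  where
  -- Before any transposition the graph consists of `a` bundles of `b` parallel edges, and the index
  -- within the bundle is a proper colouring.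
  base : Proper a b (endpoint a b) (λ e → proj₂ (remQuot {a} b e))
  base {e} {e′} p q = begin
    e                                   ≡⟨ combine-remQuot {a} b e ⟨
    uncurry combine (remQuot {a} b e)   ≡⟨ cong₂ combine p q ⟩
    uncurry combine (remQuot {a} b e′)  ≡⟨ combine-remQuot {a} b e′ ⟩
    e′                                  ∎

-- Sequential updates of a block of coordinates

Misses : ∀ {N k l} → (Fin k → Fin N) → (Fin l → Fin N) → Set
Misses φ ψ = ∀ i j → φ i ≢ ψ j

module _ {A : Set ℓ} where

  read : ∀ {N k} → (Fin k → Fin N) → Vec A N → Vec A k
  read φ z = tabulate (lookup z ∘ φ)

  assign : ∀ {N} → Fin N → (Vec A N → A) → Instruction A N
  assign i F = (λ z → z [ i ]≔ F z) , λ j j′ j-moves j′-moves →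
    trans (at-i j j-moves) (sym (at-i j′ j′-moves))
    where
    at-i : ∀ j → ¬ Trivial (λ z → z [ i ]≔ F z) j → j ≡ i
    at-i j j-moves with j ≟ i
    ... | yes j≡i = j≡i
    ... | no  j≢i = contradiction (λ z → lookup∘update′ j≢i z (F z)) j-moves

  -- Each instruction evaluates `G` on the current state, not on the initial one. The block
  -- therefore ends up holding the initial value of `G` provided that `G` is insensitive to the
  -- block, which is the condition `inv` in `read-write`.
  write : ∀ {N k} → (Fin k → Fin N) → (Vec A N → Vec A k) → Program A N k
  write {k = zero}  φ G = []
  write {k = suc k} φ G = assign (φ zero) (head ∘ G) ∷ write (φ ∘ suc) (tail ∘ G)

  lookup-write : ∀ {N k} (φ : Fin k → Fin N) G z {j} → (∀ i → φ i ≢ j) →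
                 lookup (run (write φ G) z) j ≡ lookup z j
  lookup-write {k = zero}  φ G z misses = refl
  lookup-write {k = suc k} φ G z misses = trans
    (lookup-write (φ ∘ suc) (tail ∘ G) _ (misses ∘ suc))
    (lookup∘update′ (misses zero ∘ sym) z (head (G z)))

  read-write-misses : ∀ {N k l} {φ : Fin k → Fin N} {ψ : Fin l → Fin N} →
                      Misses φ ψ → ∀ G z → read ψ (run (write φ G) z) ≡ read ψ z
  read-write-misses {φ = φ} misses G z = tabulate-cong λ j → lookup-write φ G z λ i → misses i j

  read-write : ∀ {N k} {φ : Fin k → Fin N} → Injective _≡_ _≡_ φ →
               ∀ {G} → (∀ z i a → G (z [ φ i ]≔ a) ≡ G z) →
               ∀ z → read φ (run (write φ G) z) ≡ G z
  read-write {k = zero}          φ-inj {G} inv z with [] ← G z = refl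
  read-write {k = suc k} {φ = φ} φ-inj {G} inv z = begin
    read φ (run (write φ G) z)    ≡⟨ cong₂ _∷_ first rest ⟩
    head (G z) ∷ tail (G z)       ≡⟨ head∷tail (G z) ⟩
    G z                           ∎
    where
    head∷tail : ∀ {n} (v : Vec A (suc n)) → head v ∷ tail v ≡ v
    head∷tail (_ ∷ _) = refl

    z′ : Vec A _
    z′ = z [ φ zero ]≔ head (G z)

    first : lookup (run (write (φ ∘ suc) (tail ∘ G)) z′) (φ zero) ≡ head (G z)
    first = trans (lookup-write (φ ∘ suc) (tail ∘ G) z′ (λ i eq → case φ-inj eq of λ ()))
                  (lookup∘update (φ zero) z (head (G z)))

    rest : read (φ ∘ suc) (run (write (φ ∘ suc) (tail ∘ G)) z′) ≡ tail (G z)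
    rest = trans (read-write (λ eq → case φ-inj eq of λ { refl → refl })
                             (λ y i a → cong tail (inv y (suc i) a)) z′)
                 (cong tail (inv z zero (head (G z))))

  -- `F` sees the state only through `ψ` and `ψ′`; when `φ` misses both, the invariance asked for by
  -- `read-write` is automatic.
  write₂ : ∀ {N k l l′} → (Fin k → Fin N) → (Fin l → Fin N) → (Fin l′ → Fin N) →
           (Vec A (l + l′) → Vec A k) → Program A N k
  write₂ φ ψ ψ′ F = write φ (λ z → F (read ψ z ++ read ψ′ z))

  read-update : ∀ {N k} (ψ : Fin k → Fin N) {i} → (∀ j → i ≢ ψ j) →
                ∀ z a → read ψ (z [ i ]≔ a) ≡ read ψ z
  read-update ψ misses z a = tabulate-cong λ j → lookup∘update′ (misses j ∘ sym) z a

  read-write₂ : ∀ {N k l l′} {φ : Fin k → Fin N} {ψ : Fin l → Fin N} {ψ′ : Fin l′ → Fin N} →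
                Injective _≡_ _≡_ φ → Misses φ ψ → Misses φ ψ′ →
                ∀ F z → read φ (run (write₂ φ ψ ψ′ F) z) ≡ F (read ψ z ++ read ψ′ z)
  read-write₂ {ψ = ψ} {ψ′} φ-inj misses misses′ F =
    read-write φ-inj λ z i a → cong F (cong₂ _++_
      (read-update ψ (misses i) z a) (read-update ψ′ (misses′ i) z a))

  run-++ : ∀ {N L L′} (p : Program A N L) (p′ : Program A N L′) z →
           run (p ++ p′) z ≡ run p′ (run p z)
  run-++ []      p′ z = refl
  run-++ (g ∷ p) p′ z = run-++ p p′ (proj₁ g z)

  take-tabulate : ∀ m {n} (g : Fin (m + n) → A) → take m (tabulate g) ≡ tabulate (g ∘ (_↑ˡ n))
  take-tabulate zero    g = refl
  take-tabulate (suc m) g = cong (g zero ∷_) (take-tabulate m (g ∘ suc))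

  drop-tabulate : ∀ m {n} (g : Fin (m + n) → A) → drop m (tabulate g) ≡ tabulate (g ∘ (m ↑ʳ_))
  drop-tabulate zero    g = refl
  drop-tabulate (suc m) g = drop-tabulate m (g ∘ suc)

-- The program of three assignments to disjoint blocks.

↑ˡ≢↑ʳ : ∀ {m n} (i : Fin m) (j : Fin n) → i ↑ˡ n ≢ m ↑ʳ j
↑ˡ≢↑ʳ {m} {n} i j eq =
  case trans (sym (splitAt-↑ˡ m i n)) (trans (cong (splitAt m) eq) (splitAt-↑ʳ m n j)) of λ ()

module _ {A : Set ℓ} {m N : ℕ} {ι : Fin ((m + m) + m) → Fin N} (ι-inj : Injective _≡_ _≡_ ι) where

  private
    layout : Fin (m + m) → Fin N
    layout = ι ∘ (_↑ˡ m)

    U V W : Fin m → Fin N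
    U = layout ∘ (_↑ˡ m)
    V = layout ∘ (m ↑ʳ_)
    W = ι ∘ ((m + m) ↑ʳ_)

    U-inj : Injective _≡_ _≡_ U
    U-inj = ↑ˡ-injective m _ _ ∘ ↑ˡ-injective m _ _ ∘ ι-inj

    V-inj : Injective _≡_ _≡_ V
    V-inj = ↑ʳ-injective m _ _ ∘ ↑ˡ-injective m _ _ ∘ ι-inj

    W-inj : Injective _≡_ _≡_ W
    W-inj = ↑ʳ-injective (m + m) _ _ ∘ ι-inj

    flip : ∀ {k l} {φ : Fin k → Fin N} {ψ : Fin l → Fin N} → Misses φ ψ → Misses ψ φ
    flip misses i j = misses j i ∘ sym

    U-V : Misses U V
    U-V i j = ↑ˡ≢↑ʳ i j ∘ ↑ˡ-injective m _ _ ∘ ι-inj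

    U-W : Misses U W
    U-W i j = ↑ˡ≢↑ʳ (i ↑ˡ m) j ∘ ι-inj

    V-W : Misses V W
    V-W i j = ↑ˡ≢↑ʳ (m ↑ʳ i) j ∘ ι-inj

    read-layout : ∀ (z : Vec A N) → read layout z ≡ read U z ++ read V z
    read-layout z = trans (sym (take++drop≡id m _))
      (cong₂ _++_ (take-tabulate m _) (drop-tabulate m _))

  -- The blocks (U, V, W) go through (u, v, w), (f₁, v, w) and (f₁, f₂, w).
  module ThreeBlocks (f : Transformation A (m + m)) (w F-U F-V : Vec A (m + m) → Vec A m)
                     (F-U-spec : ∀ x → F-U (drop m x ++ w x) ≡ take m (f x))
                     (F-V-spec : ∀ x → F-V (take m (f x) ++ w x) ≡ drop m (f x)) where

    store write-U write-V : Program A N m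
    store   = write₂ W U V w
    write-U = write₂ U V W F-U
    write-V = write₂ V U W F-V

    program : Program A N (m + (m + m))
    program = store ++ (write-U ++ write-V)

    module _ (z : Vec A N) where

      x : Vec A (m + m)
      x = read layout z

      z₁ z₂ z₃ : Vec A N
      z₁ = run store z
      z₂ = run write-U z₁
      z₃ = run write-V z₂

      -- The values stored in `W` are computed from `U` and `V` alone, so this holds for arbitrary
      -- initial memory.
      W₁ : read W z₁ ≡ w x
      W₁ = trans (read-write₂ W-inj (flip U-W) (flip V-W) w z) (cong w (sym (read-layout z)))

      V₁ : read V z₁ ≡ drop m x
      V₁ = trans (read-write-misses (flip V-W) _ z) (sym (drop-tabulate m _))

      U₂ : read U z₂ ≡ take m (f x)
      U₂ = begin
        read U z₂                     ≡⟨ read-write₂ U-inj U-V U-W F-U z₁ ⟩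
        F-U (read V z₁ ++ read W z₁)  ≡⟨ cong F-U (cong₂ _++_ V₁ W₁) ⟩
        F-U (drop m x ++ w x)         ≡⟨ F-U-spec x ⟩
        take m (f x)                  ∎

      W₂ : read W z₂ ≡ w x
      W₂ = trans (read-write-misses U-W _ z₁) W₁

      U₃ : read U z₃ ≡ take m (f x)
      U₃ = trans (read-write-misses (flip U-V) _ z₂) U₂

      V₃ : read V z₃ ≡ drop m (f x)
      V₃ = begin
        read V z₃                     ≡⟨ read-write₂ V-inj (flip U-V) V-W F-V z₂ ⟩
        F-V (read U z₂ ++ read W z₂)  ≡⟨ cong F-V (cong₂ _++_ U₂ W₂) ⟩
        F-V (take m (f x) ++ w x)     ≡⟨ F-V-spec x ⟩
        drop m (f x)                  ∎

      correct : read layout (run program z) ≡ f x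
      correct = begin
        read layout (run program z)
          ≡⟨ cong (read layout)
               (trans (run-++ store (write-U ++ write-V) z) (run-++ write-U write-V z₁)) ⟩
        read layout z₃
          ≡⟨ read-layout z₃ ⟩
        read U z₃ ++ read V z₃
          ≡⟨ cong₂ _++_ U₃ V₃ ⟩
        take m (f x) ++ drop m (f x)
          ≡⟨ take++drop≡id m (f x) ⟩
        f x ∎

  three-blocks : (f : Transformation A (m + m)) (w F-U F-V : Vec A (m + m) → Vec A m) →
                 (∀ x → F-U (drop m x ++ w x) ≡ take m (f x)) →
                 (∀ x → F-V (take m (f x) ++ w x) ≡ drop m (f x)) →
                 Σ (Program A N (m + (m + m))) λ p →
                   ∀ z → read (ι ∘ (_↑ˡ m)) (run p z) ≡ f (read (ι ∘ (_↑ˡ m)) z)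
  three-blocks f w F-U F-V F-U-spec F-V-spec =
    ThreeBlocks.program f w F-U F-V F-U-spec F-V-spec ,
    ThreeBlocks.correct f w F-U F-V F-U-spec F-V-spec

-- From edge colourings to programs.

module _ {A : Set ℓ} {q : ℕ} (A↔q : A ↔ Fin q) where

  Vec↔^ : ∀ m → Vec A m ↔ Fin (q ^ m)
  Vec↔^ zero    = mk↔ₛ′ (λ _ → zero) (λ _ → []) (λ { zero → refl }) (λ { [] → refl })
  Vec↔^ (suc m) = ↔-sym *↔× ↔-∘ ((A↔q ×-↔ Vec↔^ m) ↔-∘
    mk↔ₛ′ (λ v → head v , tail v) (uncurry _∷_) (λ _ → refl) (λ { (_ ∷ _) → refl }))

  ++↔ : ∀ m n → Vec A (m + n) ↔ (Vec A m × Vec A n)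
  ++↔ m n = mk↔ₛ′ (λ v → take m v , drop m v) (uncurry _++_)
    (λ (v , w) → uncurry (cong₂ _,_) (++-injective _ _ (take++drop≡id m (v ++ w))))
    (take++drop≡id m)

  opaque
    -- The graph has an edge from drop m x to take m (f x) for each x, and w x is
    -- its colour.
    routing : ∀ m {f : Transformation A (m + m)} → Inj f →
              ∃ λ (w : Vec A (m + m) → Vec A m) →
                Inj (λ x → drop m x ++ w x) × Inj (λ x → take m (f x) ++ w x)
    routing m {f} f-inj = w , w-proper proper-in endpoint-in , w-proper proper-out endpoint-out
      where
      open Inverse (Vec↔^ m) using () renaming (to to code; from to decode)

      blocks : Vec A (m + m) ↔ (Fin (q ^ m) × Fin (q ^ m))
      blocks = (Vec↔^ m ×-↔ Vec↔^ m) ↔-∘ ++↔ m m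

      -- `endpoint` reads off the first component, so `in↔` swaps the halves to put `drop m` first,
      -- while `out↔` keeps `take m` first.
      in↔ out↔ : Vec A (m + m) ↔ Fin (q ^ m * q ^ m)
      in↔  = ↔-sym *↔× ↔-∘ (×-comm _ _ ↔-∘ blocks)
      out↔ = ↔-sym *↔× ↔-∘ blocks

      in-edge : Vec A (m + m) → Fin (q ^ m * q ^ m)
      in-edge = Inverse.to in↔

      -- Edges are numbered by their inputs through `in↔`; `π` is `f` expressed between the two
      -- numberings, so `endpoint` after `π` gives the first half of the output.
      π : Permutation′ (q ^ m * q ^ m)
      π = out↔ ↔-∘ (finite-injective⇒↔ (Vec↔^ (m + m)) f-inj ↔-∘ ↔-sym in↔)

      left : Fin (q ^ m * q ^ m) → Fin (q ^ m)
      left = endpoint (q ^ m) (q ^ m)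

      c : Fin (q ^ m * q ^ m) → Fin (q ^ m)
      c = proj₁ (colouring {q ^ m} {q ^ m} π)

      proper-in : Proper (q ^ m) (q ^ m) left c
      proper-in = proj₁ (proj₂ (colouring {q ^ m} {q ^ m} π))

      proper-out : Proper (q ^ m) (q ^ m) (left ∘ (π ⟨$⟩ʳ_)) c
      proper-out = proj₂ (proj₂ (colouring {q ^ m} {q ^ m} π))

      w : Vec A (m + m) → Vec A m
      w x = decode (c (in-edge x))

      endpoint-in : ∀ x → left (in-edge x) ≡ code (drop m x)
      endpoint-in x = cong proj₁ (remQuot-combine (code (drop m x)) (code (take m x)))

      endpoint-out : ∀ x → left (π ⟨$⟩ʳ in-edge x) ≡ code (take m (f x))
      endpoint-out x = begin
        left (π ⟨$⟩ʳ in-edge x)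
          ≡⟨ cong (left ∘ Inverse.to out↔ ∘ f) (Inverse.strictlyInverseʳ in↔ x) ⟩
        left (Inverse.to out↔ (f x))
          ≡⟨ cong proj₁ (remQuot-combine (code (take m (f x))) (code (drop m (f x)))) ⟩
        code (take m (f x)) ∎

      w-proper : ∀ {r} → Proper (q ^ m) (q ^ m) r c → {g : Vec A (m + m) → Vec A m} →
                 (∀ x → r (in-edge x) ≡ code (g x)) → Inj (λ x → g x ++ w x)
      w-proper proper {g} r≡g {x} {x′} eq =
        let g-eq , w-eq = ++-injective (g x) (g x′) eq
        in ↔-injective in↔ (proper
             (trans (r≡g x) (trans (cong code g-eq) (sym (r≡g x′))))
             (↔-injective (↔-sym (Vec↔^ m)) w-eq))

  -- The two injective maps from `routing` act on a finite set, so they have inverses. These recover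
  -- `x` from the two blocks being read, and applying `f` then yields the half to be written.
  three-block-program : ∀ {m N} {ι : Fin ((m + m) + m) → Fin N} → Injective _≡_ _≡_ ι →
    {f : Transformation A (m + m)} → Inj f →
    Σ (Program A N (m + (m + m))) λ p →
      ∀ z → read (ι ∘ (_↑ˡ m)) (run p z) ≡ f (read (ι ∘ (_↑ˡ m)) z)
  three-block-program {m} ι-inj {f} f-inj =
    let w , w-in , w-out = routing m f-inj
        recover-in  = finite-injective⇒↔ (Vec↔^ (m + m)) w-in
        recover-out = finite-injective⇒↔ (Vec↔^ (m + m)) w-out
    in three-blocks ι-inj f w
         (take m ∘ f ∘ Inverse.from recover-in)
         (drop m ∘ f ∘ Inverse.from recover-out)
         (λ x → cong (take m ∘ f) (Inverse.strictlyInverseʳ recover-in x))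
         (λ x → cong (drop m ∘ f) (Inverse.strictlyInverseʳ recover-out x))

  -- Common to both parities: `ι` places the coordinates of `g` and its `m` work cells among the
  -- actual `n + k` ones, and `simulates` finds each output of `f` among those of `g`.
  compute : ∀ {n m k N} (f : Transformation A n) (g : Transformation A N) → N ≡ m + m → Inj g →
            (ι : Fin (N + m) → Fin (n + k)) → Injective _≡_ _≡_ ι →
            (∀ i x y → ∃[ j ] ι (j ↑ˡ m) ≡ i ↑ˡ k ×
               lookup (g (read (ι ∘ (_↑ˡ m)) (x ++ y))) j ≡ lookup (f x) i) →
            ComputedInAtMost f (3 * m) k
  compute {m = m} f g refl g-inj ι ι-inj simulates with three-block-program {m = m} ι-inj g-inj
  ... | p , p-computes-g =
    m + (m + m) , ℕ.≤-reflexive (cong (λ l → m + (m + l)) (sym (ℕ.+-identityʳ m))) ,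
    p , run p , (λ _ → refl) , λ i x y →
      let j , ιj≡i , gj≡fi = simulates i x y in begin
        lookup (run p (x ++ y)) (i ↑ˡ _)
          ≡⟨ cong (lookup (run p (x ++ y))) ιj≡i ⟨
        lookup (run p (x ++ y)) (ι (j ↑ˡ m))
          ≡⟨ lookup∘tabulate (lookup (run p (x ++ y)) ∘ ι ∘ (_↑ˡ m)) j ⟨
        lookup (read (ι ∘ (_↑ˡ m)) (run p (x ++ y))) j
          ≡⟨ cong (λ v → lookup v j) (p-computes-g (x ++ y)) ⟩
        lookup (g (read (ι ∘ (_↑ˡ m)) (x ++ y))) j
          ≡⟨ gj≡fi ⟩
        lookup (f x) i ∎

  -- The even and the odd case.

  read-++ˡ : ∀ {n k} (x : Vec A n) (y : Vec A k) {φ : Fin n → Fin (n + k)} →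
             (∀ i → φ i ≡ i ↑ˡ k) → read φ (x ++ y) ≡ x
  read-++ˡ x y φ≡ = trans
    (tabulate-cong λ i → trans (cong (lookup (x ++ y)) (φ≡ i)) (lookup-++ˡ x y i))
    (tabulate∘lookup x)

  even : ∀ {n m} (f : Transformation A n) → Inj f → n ≡ 2 * m → ComputedInAtMost f (3 * m) m
  even {m = m} f f-inj n≡2m =
    compute f f (trans n≡2m (cong (m +_) (ℕ.+-identityʳ m))) f-inj id id λ i x y →
      i , refl , cong (λ v → lookup (f v) i) (read-++ˡ x y (λ _ → refl))

  -- With one memory cell as an extra coordinate the length becomes `2 * (m + 1)`, so blocks have
  -- size `m + 1` and `3 * (m + 1)` instructions suffice. The borrowed cell and a block of `m + 1`
  -- work cells make `m + 2`.
  odd : ∀ {n m} (f : Transformation A n) → Inj f → n ≡ 2 * m + 1 →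
        ComputedInAtMost f (3 * m + 3) (m + 2)
  odd {n} {m} f f-inj n≡2m+1 =
    subst (λ L → ComputedInAtMost f L (m + 2)) (ℕ.*-distribˡ-+ 3 m 1)
      (compute f padded n+1≡ padded-inj (cast shift) cast-inj λ i x y →
        i ↑ˡ 1 , layout-↑ˡ i , (begin
          lookup (padded (read layout (x ++ y))) (i ↑ˡ 1)
            ≡⟨ lookup-++ˡ (f (take n (read layout (x ++ y)))) _ i ⟩
          lookup (f (take n (read layout (x ++ y)))) i
            ≡⟨ cong (λ v → lookup (f v) i) (trans (take-tabulate n _) (read-++ˡ x y layout-↑ˡ)) ⟩
          lookup (f x) i ∎))
    where
    padded : Transformation A (n + 1)
    padded z = f (take n z) ++ drop n z

    padded-inj : Inj padded
    padded-inj {z} {z′} eq =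
      let f-eq , drop-eq = ++-injective (f (take n z)) (f (take n z′)) eq in begin
        z                         ≡⟨ take++drop≡id n z ⟨
        take n z ++ drop n z      ≡⟨ cong₂ _++_ (f-inj f-eq) drop-eq ⟩
        take n z′ ++ drop n z′    ≡⟨ take++drop≡id n z′ ⟩
        z′                        ∎

    -- Only the bracketing changes, so `cast shift` keeps every index in place and the extra
    -- coordinate of `padded` is the first memory cell.
    shift : (n + 1) + (m + 1) ≡ n + (m + 2)
    shift = trans (ℕ.+-assoc n 1 (m + 1)) (cong (n +_) (sym (ℕ.+-suc m 1)))

    layout : Fin (n + 1) → Fin (n + (m + 2))
    layout = cast shift ∘ (_↑ˡ (m + 1))

    n+1≡ : n + 1 ≡ (m + 1) + (m + 1)
    n+1≡ = begin
      n + 1                    ≡⟨ cong (_+ 1) n≡2m+1 ⟩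
      2 * m + 1 + 1            ≡⟨ ℕ.+-assoc (2 * m) 1 1 ⟩
      2 * m + 2                ≡⟨ ℕ.*-distribˡ-+ 2 m 1 ⟨
      2 * (m + 1)              ≡⟨ cong ((m + 1) +_) (ℕ.+-identityʳ (m + 1)) ⟩
      (m + 1) + (m + 1)        ∎

    cast-inj : Injective _≡_ _≡_ (cast shift)
    cast-inj {i} {j} eq = toℕ-injective (begin
      toℕ i               ≡⟨ toℕ-cast shift i ⟨
      toℕ (cast shift i)  ≡⟨ cong toℕ eq ⟩
      toℕ (cast shift j)  ≡⟨ toℕ-cast shift j ⟩
      toℕ j               ∎)

    layout-↑ˡ : ∀ i → layout (i ↑ˡ 1) ≡ i ↑ˡ (m + 2)
    layout-↑ˡ i = toℕ-injective (begin
      toℕ (layout (i ↑ˡ 1))      ≡⟨ toℕ-cast shift _ ⟩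
      toℕ ((i ↑ˡ 1) ↑ˡ (m + 1))  ≡⟨ toℕ-↑ˡ (i ↑ˡ 1) (m + 1) ⟩
      toℕ (i ↑ˡ 1)               ≡⟨ toℕ-↑ˡ i 1 ⟩
      toℕ i                      ≡⟨ toℕ-↑ˡ i (m + 2) ⟨
      toℕ (i ↑ˡ (m + 2))         ∎)

theorem5 : ∀ {a} (A : Set a) (q : ℕ) → A ↔ Fin q → 2 ≤ q →
    (n : ℕ) → 2 ≤ n → (f : Transformation A n) → IsPermutation f →
    ((m : ℕ) → n ≡ 2 * m → ComputedInAtMost f (3 * m) m) ×
    ((m : ℕ) → n ≡ 2 * m + 1 → ComputedInAtMost f (3 * m + 3) (m + 2))
theorem5 A q A↔q _ n _ f (f-inj , _) =
  (λ m → even A↔q f f-inj) , (λ m → odd A↔q f f-inj)
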